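{- Let $V$ be a finite set and let $h: 2^V\rightarrow \mathbb{Z}_{\ge 0}$ be an integer-valued normalized non-decreasing submodular function. Then there exists a normalized supermodular function $f:2^V\rightarrow \mathbb{Z}_{\ge 0}$ such that (1) for every $F\subseteq V$, we have $h(F)\ge h(V)$ if and only if $\lambda^*_{f|_{V-F}}\le 1$; (2) $f(v\,|\,V-v) = h(\{v\}) + 1$ for all $v \in V$; and (3) evaluation queries for the function $f$ (given $S\subseteq V$, return $f(S)$) can be answered in polynomial time by making a constant number of evaluation queries to the function $h$.
   Context: For a finite set $V$, a set function $f:2^V\to\mathbb{R}$ is submodular if $f(A)+f(B)\ge f(A\cap B)+f(A\cup B)$ for all $A,B\subseteq V$; supermodular if $-f$ is submodular; non-decreasing if $f(A)\le f(B)$ whenever $A\subseteq B\subseteq V$; normalized if $f(\emptyset)=0$. The marginal of $v\in V$ with respect to $S\subseteq V$ is $f(v\,|\,S):=f(S\cup\{v\})-f(S)$, and $V-v:=V\setminus\{v\}$. For $F\subseteq V$, $f|_{V-F}$ is the restriction of $f$ to subsets of $V\setminus F$. The density of a set function $f$ on ground set $V$ is $\lambda^*_f:=\max\{f(S)/|S| : \emptyset\ne S\subseteq V\}$; for an empty ground set the condition $\lambda^*_f\le 1$ is considered to hold. An evaluation oracle for a set function takes $S\subseteq V$ and returns the function value of $S$. -}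

module Defs where

open import Data.Bool using (Bool; true; false; if_then_else_)
open import Data.Fin using (Fin; toℕ)
open import Data.Fin.Subset using (Subset; _⊆_; _∩_; _∪_; ⊥; ⁅_⁆; ∣_∣; Nonempty; Empty)
open import Data.Fin.Subset.Properties using (x∈p⇒∣p-x∣<∣p∣)
open import Data.Integer as ℤ using (ℤ; +_)
open import Data.List using (List; []; _∷_)
open import Data.Nat using (ℕ; zero; suc; _+_; _*_; _∸_; _≤_; _>_; _≡ᵇ_; _<ᵇ_; z≤n; NonZero; >-nonZero)
open import Data.Nat.Logarithm using (⌊log₂_⌋)
open import Data.Nat.Properties using (≤-<-trans)
open import Data.Product using (Σ; ∃-syntax; _×_; _,_; proj₁)
open import Data.Rational as ℚ using (ℚ; 1ℚ)
open import Data.Sum using (_⊎_)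
open import Data.Vec using ([]; _∷_; tabulate)
open import Relation.Binary.PropositionalEquality using (_≡_)

private variable
  n : ℕ

toℤ : {A : Set} → (A → ℕ) → A → ℤ
toℤ f S = + f S

Normalized : (Subset n → ℤ) → Set
Normalized f = f ⊥ ≡ + 0

NonDecreasing : (Subset n → ℤ) → Set
NonDecreasing {n} f = (A B : Subset n) → A ⊆ B → f A ℤ.≤ f B

Submodular : (Subset n → ℤ) → Set
Submodular {n} f = (A B : Subset n) → f A ℤ.+ f B ℤ.≥ f (A ∩ B) ℤ.+ f (A ∪ B)

Supermodular : (Subset n → ℤ) → Set
Supermodular f = Submodular (λ S → ℤ.- f S)

marginal : (Subset n → ℤ) → Fin n → Subset n → ℤ
marginal f v S = f (S ∪ ⁅ v ⁆) ℤ.- f S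

-- 2^U for a ground set U ⊆ V.
Powerset : Subset n → Set
Powerset {n} U = Σ (Subset n) (_⊆ U)

restrict : (Subset n → ℤ) → (U : Subset n) → Powerset U → ℤ
restrict f U (S , _) = f S

nonempty⇒nonZero : {S : Subset n} → Nonempty S → NonZero ∣ S ∣
nonempty⇒nonZero (_ , x∈S) = >-nonZero (≤-<-trans z≤n (x∈p⇒∣p-x∣<∣p∣ x∈S))

ratio : {U : Subset n} (g : Powerset U → ℤ) (S : Powerset U) → Nonempty (proj₁ S) → ℚ
ratio g S ne = ℚ._/_ (g S) ∣ proj₁ S ∣ {{nonempty⇒nonZero ne}}

-- d = max { g(S)/|S| : ∅ ≠ S ⊆ U }; no such d exists when U is empty.
record IsDensity {U : Subset n} (g : Powerset U → ℤ) (d : ℚ) : Set where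
  field
    attained   : ∃[ S ] Σ (Nonempty (proj₁ S)) λ ne → ratio g S ne ≡ d
    upperBound : (S : Powerset U) (ne : Nonempty (proj₁ S)) → ratio g S ne ℚ.≤ d

DensityAtMostOne : {U : Subset n} → (Powerset U → ℤ) → Set
DensityAtMostOne {U = U} g = Empty U ⊎ (∃[ d ] IsDensity g d × d ℚ.≤ 1ℚ)

-- Algorithms are programs for an oracle random access machine: registers X₀, X₁, …
-- holding natural numbers, read-only access to the input set S ⊆ V = {0,…,n-1},
-- and a write-only oracle tape of bits describing the next set to be queried.
-- The arguments of instructions are register numbers, except for the literal in `const`.
data Program : Set where
  skip   : Program
  const  : (i k : ℕ) → Program      -- Xᵢ ← k
  add    : (i j k : ℕ) → Program    -- Xᵢ ← Xⱼ + Xₖ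
  sub    : (i j k : ℕ) → Program    -- Xᵢ ← Xⱼ ∸ Xₖ
  load   : (i j : ℕ) → Program      -- Xᵢ ← X at address Xⱼ
  store  : (i j : ℕ) → Program      -- X at address Xᵢ ← Xⱼ
  ground : (i : ℕ) → Program        -- Xᵢ ← n
  member : (i j : ℕ) → Program      -- Xᵢ ← 1 if Xⱼ ∈ S, else 0
  write  : (i j : ℕ) → Program      -- oracle tape at position Xᵢ ← (Xⱼ > 0)
  query  : (i : ℕ) → Program        -- Xᵢ ← oracle value of the set on the oracle tape
  _⨾_    : Program → Program → Program
  ifPos  : (j : ℕ) → Program → Program → Program
  while  : (j : ℕ) → Program → Program    -- while Xⱼ > 0

infixr 5 _⨾_

record State : Set where
  constructor ⟪_,_⟫
  field
    reg  : ℕ → ℕ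
    tape : ℕ → Bool

open State public

initial : State
initial = ⟪ (λ _ → 0) , (λ _ → false) ⟫

_[_↦_] : {A : Set} → (ℕ → A) → ℕ → A → ℕ → A
(m [ i ↦ x ]) j = if j ≡ᵇ i then x else m j

setReg : State → ℕ → ℕ → State
setReg σ i x = ⟪ reg σ [ i ↦ x ] , tape σ ⟫

setTape : State → ℕ → Bool → State
setTape σ i b = ⟪ reg σ , tape σ [ i ↦ b ] ⟫

-- 0 outside the range {0,…,n-1}.
indicator : Subset n → ℕ → ℕ
indicator []          _       = 0
indicator (true  ∷ _) zero    = 1
indicator (false ∷ _) zero    = 0
indicator (_     ∷ S) (suc i) = indicator S i

tapeSet : State → Subset n
tapeSet σ = tabulate λ i → tape σ (toℕ i)

-- Length of the binary representation (1 for zero).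
size : ℕ → ℕ
size x = suc ⌊log₂ x ⌋

-- Run h S P σ σ′ t q: with oracle h and input set S, the program P started in σ halts
-- in σ′ after time t and q oracle queries.  Time is the logarithmic cost: one plus the
-- bit lengths of the numbers and computed addresses handled by the instruction; a query
-- costs one plus the length n of the query plus the bit length of the answer.
data Run {n : ℕ} (h : Subset n → ℕ) (S : Subset n) : Program → State → State → ℕ → ℕ → Set where
  skip : ∀ {σ} → Run h S skip σ σ 1 0

  const : ∀ {σ i k} →
    Run h S (const i k) σ (setReg σ i k) (1 + size k) 0

  add : ∀ {σ i j k} →
    Run h S (add i j k) σ (setReg σ i (reg σ j + reg σ k)) (1 + size (reg σ j) + size (reg σ k)) 0

  sub : ∀ {σ i j k} →
    Run h S (sub i j k) σ (setReg σ i (reg σ j ∸ reg σ k)) (1 + size (reg σ j) + size (reg σ k)) 0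

  load : ∀ {σ i j} →
    Run h S (load i j) σ (setReg σ i (reg σ (reg σ j))) (1 + size (reg σ j) + size (reg σ (reg σ j))) 0

  store : ∀ {σ i j} →
    Run h S (store i j) σ (setReg σ (reg σ i) (reg σ j)) (1 + size (reg σ i) + size (reg σ j)) 0

  ground : ∀ {σ i} →
    Run h S (ground i) σ (setReg σ i n) (1 + size n) 0

  member : ∀ {σ i j} →
    Run h S (member i j) σ (setReg σ i (indicator S (reg σ j))) (1 + size (reg σ j)) 0

  write : ∀ {σ i j} →
    Run h S (write i j) σ (setTape σ (reg σ i) (0 <ᵇ reg σ j)) (1 + size (reg σ i) + size (reg σ j)) 0

  query : ∀ {σ i} →
    Run h S (query i) σ (setReg σ i (h (tapeSet σ))) (1 + n + size (h (tapeSet σ))) 1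

  seq : ∀ {P Q σ σ′ σ″ t t′ q q′} →
    Run h S P σ σ′ t q → Run h S Q σ′ σ″ t′ q′ →
    Run h S (P ⨾ Q) σ σ″ (t + t′) (q + q′)

  ifTrue : ∀ {j P Q σ σ′ t q} → reg σ j > 0 →
    Run h S P σ σ′ t q →
    Run h S (ifPos j P Q) σ σ′ (1 + size (reg σ j) + t) q

  ifFalse : ∀ {j P Q σ σ′ t q} → reg σ j ≡ 0 →
    Run h S Q σ σ′ t q →
    Run h S (ifPos j P Q) σ σ′ (1 + size (reg σ j) + t) q

  whileTrue : ∀ {j P σ σ′ σ″ t t′ q q′} → reg σ j > 0 →
    Run h S P σ σ′ t q → Run h S (while j P) σ′ σ″ t′ q′ →
    Run h S (while j P) σ σ″ (1 + size (reg σ j) + t + t′) (q + q′)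

  whileFalse : ∀ {j P σ} → reg σ j ≡ 0 →
    Run h S (while j P) σ σ (1 + size (reg σ j)) 0

-- a₀ ∷ a₁ ∷ … stands for a₀ + a₁ x + ….
Polynomial : Set
Polynomial = List ℕ

eval : Polynomial → ℕ → ℕ
eval []      x = 0
eval (a ∷ p) x = a + x * eval p x

-- With evaluation oracle h, the program P answers every evaluation query for f (result
-- in X₀) with at most c oracle queries, in time polynomial, as witnessed by p, in |V|
-- and any bound L on the bit lengths of the oracle values.
AnswersQueries : Program → Polynomial → ℕ → (h f : Subset n → ℕ) → Set
AnswersQueries {n} P p c h f =
  (S : Subset n) →
  ∃[ σ ] ∃[ t ] ∃[ q ]
    Run h S P initial σ t q
    × reg σ 0 ≡ f S
    × q ≤ c
    × ((L : ℕ) → ((T : Subset n) → size (h T) ≤ L) → t ≤ eval p (n + L))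

{-# OPTIONS --safe #-}

-- Take f(S) = |S| + h(V) − h(V ∖ S).  Since h is non-decreasing, f(S) ≥ |S|, with equality iff
-- h(V ∖ S) = h(V).  So f|_{V−F} has density at most 1 iff h(V ∖ S) = h(V) for every S ⊆ V ∖ F,
-- and by monotonicity the case S = V ∖ F implies the others.  Complementation preserves
-- submodularity and |·| is modular, so f is supermodular.  An evaluation of f asks h for the
-- values at V and at V ∖ S.
module Submission where

open import Defs
open import Algebra.Lattice.Properties.BooleanAlgebra using (deMorgan₁; deMorgan₂; ¬⊤≈⊥; ¬⊥≈⊤; ¬-involutive)
open import Data.Bool using (Bool; true; false)
open import Data.Fin using (Fin; toℕ; zero; suc)
open import Data.Fin.Properties using (toℕ<n)
open import Data.Fin.Subset using (Subset; ⊤; ⊥; ∁; ⁅_⁆; _-_; _─_; _∩_; _∪_; ∣_∣; _⊆_)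
open import Data.Fin.Subset.Properties using (∪-∩-booleanAlgebra; ∣⊤∣≡n; ∣⊥∣≡0; ∣⁅x⁆∣≡1; ∣∁p∣≡n∸∣p∣; ∣p∣≤n; p∪∁p≡⊤; ∪-comm; ⊆⊤; p⊆q⇒∁p⊇∁q; nonempty?; x∉∁p⇒x∈p; ⊆-refl)
open import Data.Integer as ℤ using (+_)
open import Data.Integer.GCD using (gcd)
import Data.Integer.Properties as ℤₚ
open import Data.List using ([]; _∷_)
open import Data.Nat using (ℕ; zero; suc; _+_; _*_; _∸_; _^_; _≤_; _<_; _≥_; _<ᵇ_; _≡ᵇ_; NonZero; z≤n; s≤s)
open import Data.Nat.Logarithm using (⌊log₂_⌋; ⌊log₂⌋-mono-≤; ⌊log₂[2^n]⌋≡n)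
open import Data.Nat.Properties
open import Data.Nat.Tactic.RingSolver using (solve-∀)
open import Data.Product using (∃-syntax; _×_; _,_)
open import Data.Rational as ℚ using (1ℚ)
import Data.Rational.Properties as ℚₚ
import Data.Rational.Unnormalised as ℚᵘ
open import Data.Sum using (inj₁; inj₂)
open import Data.Vec using ([]; _∷_; lookup)
open import Data.Vec.Properties using (lookup-replicate; tabulate∘lookup; tabulate-cong)
open import Function.Base using (_∘_)
open import Function.Bundles using (_⇔_; mk⇔)
open import Relation.Binary.PropositionalEquality using (_≡_; refl; sym; trans; cong; cong₂; subst; subst₂; module ≡-Reasoning)
open import Relation.Nullary using (yes; no; contradiction)

private variable
  n : ℕ

-- Finite sets

∣p∩q∣+∣p∪q∣≡∣p∣+∣q∣ : (p q : Subset n) → ∣ p ∩ q ∣ + ∣ p ∪ q ∣ ≡ ∣ p ∣ + ∣ q ∣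
∣p∩q∣+∣p∪q∣≡∣p∣+∣q∣ []          []          = refl
∣p∩q∣+∣p∪q∣≡∣p∣+∣q∣ (false ∷ p) (false ∷ q) = ∣p∩q∣+∣p∪q∣≡∣p∣+∣q∣ p q
∣p∩q∣+∣p∪q∣≡∣p∣+∣q∣ (true  ∷ p) (false ∷ q) =
  trans (+-suc _ _) (cong suc (∣p∩q∣+∣p∪q∣≡∣p∣+∣q∣ p q))
∣p∩q∣+∣p∪q∣≡∣p∣+∣q∣ (false ∷ p) (true  ∷ q) =
  trans (+-suc _ _) (trans (cong suc (∣p∩q∣+∣p∪q∣≡∣p∣+∣q∣ p q)) (sym (+-suc _ _)))
∣p∩q∣+∣p∪q∣≡∣p∣+∣q∣ (true  ∷ p) (true  ∷ q) =
  cong suc (trans (+-suc _ _) (trans (cong suc (∣p∩q∣+∣p∪q∣≡∣p∣+∣q∣ p q)) (sym (+-suc _ _))))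

⊤─p≡∁p : (p : Subset n) → ⊤ ─ p ≡ ∁ p
⊤─p≡∁p []          = refl
⊤─p≡∁p (false ∷ p) = cong (true ∷_) (⊤─p≡∁p p)
⊤─p≡∁p (true  ∷ p) = cong (false ∷_) (⊤─p≡∁p p)

∁-involutive : (p : Subset n) → ∁ (∁ p) ≡ p
∁-involutive = ¬-involutive (∪-∩-booleanAlgebra _)

p⊆∁q⇒q⊆∁p : {p q : Subset n} → p ⊆ ∁ q → q ⊆ ∁ p
p⊆∁q⇒q⊆∁p {p = p} {q} p⊆∁q = subst (_⊆ ∁ p) (∁-involutive q) (p⊆q⇒∁p⊇∁q p⊆∁q)

-- Rationals

-- Cross-multiplication of unnormalised fractions proves this without evaluating the gcd.
n/n≡1 : ∀ n .{{_ : NonZero n}} → + n ℚ./ n ≡ 1ℚ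
n/n≡1 (suc n) = ℚₚ.fromℚᵘ-cong {ℚᵘ.mkℚᵘ (+ suc n) n} {ℚᵘ.1ℚᵘ} (ℚᵘ.*≡* (ℤₚ.*-comm (+ suc n) (+ 1)))

-- A rational is stored in lowest terms, so its order compares the reduced numerator and
-- denominator; multiplying both by the gcd restores `m` and `n`.
m/n≤1⇒m≤n : ∀ m n .{{_ : NonZero n}} → + m ℚ./ n ℚ.≤ 1ℚ → m ≤ n
m/n≤1⇒m≤n m n (ℚ.*≤* ↥≤↧) = ℤₚ.drop‿+≤+ (subst₂ ℤ._≤_ (ℚₚ.↥-/ (+ m) n) (ℚₚ.↧-/ (+ m) n)
  (ℤₚ.*-monoʳ-≤-nonNeg (gcd (+ m) (+ n))
    (subst₂ ℤ._≤_ (ℤₚ.*-identityʳ (ℚ.↥ (+ m ℚ./ n))) (ℤₚ.*-identityˡ (ℚ.↧ (+ m ℚ./ n))) ↥≤↧)))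

-- The supermodular function

-- The second summand is the dual set function of `h`. For non-decreasing `h` the truncated
-- subtraction is exact, because `h (∁ S) ≤ h ⊤`.
dualPlusCard : (Subset n → ℕ) → Subset n → ℕ
dualPlusCard h S = ∣ S ∣ + (h ⊤ ∸ h (∁ S))

module _ {n : ℕ} (h : Subset n → ℕ) where

  private f = dualPlusCard h

  dualPlusCard-normalized : Normalized (toℤ f)
  dualPlusCard-normalized = cong +_ (begin
    ∣ ⊥ {n} ∣ + (h ⊤ ∸ h (∁ ⊥))  ≡⟨ cong₂ (λ k T → k + (h ⊤ ∸ h T)) (∣⊥∣≡0 n) (¬⊥≈⊤ (∪-∩-booleanAlgebra n)) ⟩
    h ⊤ ∸ h ⊤                    ≡⟨ n∸n≡0 (h ⊤) ⟩
    0                            ∎)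
    where open ≡-Reasoning

  module _ (mono : NonDecreasing (toℤ h)) where

    h≤h⊤ : ∀ S → h S ≤ h ⊤
    h≤h⊤ S = ℤₚ.drop‿+≤+ (mono S ⊤ ⊆⊤)

    -- Subtraction-free form of the definition: later proofs add the terms `h (∁ S)` and cancel in
    -- ℕ.
    dualPlusCard+h∘∁ : ∀ S → f S + h (∁ S) ≡ ∣ S ∣ + h ⊤
    dualPlusCard+h∘∁ S = trans (+-assoc ∣ S ∣ _ _) (cong (_+_ ∣ S ∣) (m∸n+n≡m (h≤h⊤ (∁ S))))

    -- Once `h (∁ A) + h (∁ B)` is added to `f A + f B`, the sum is modular, so it can be rewritten
    -- for `A ∩ B` and `A ∪ B`. De Morgan and submodularity of `h` at the complements then give the
    -- inequality.
    dualPlusCard-supermodular : Submodular (toℤ h) → Supermodular (toℤ f)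
    dualPlusCard-supermodular subm A B =
      subst₂ ℤ._≤_ (ℤₚ.neg-distrib-+ (+ f (A ∩ B)) (+ f (A ∪ B))) (ℤₚ.neg-distrib-+ (+ f A) (+ f B))
        (ℤₚ.neg-mono-≤ (ℤ.+≤+ (+-cancelʳ-≤ (h (∁ A) + h (∁ B)) _ _ bound)))
      where
      open ≤-Reasoning
      interchange : ∀ a b c d → (a + b) + (c + d) ≡ (a + c) + (b + d)
      interchange = solve-∀
      pair : ∀ S T → (f S + f T) + (h (∁ S) + h (∁ T)) ≡ (∣ S ∣ + ∣ T ∣) + (h ⊤ + h ⊤)
      pair S T = trans (interchange (f S) _ _ _)
        (trans (cong₂ _+_ (dualPlusCard+h∘∁ S) (dualPlusCard+h∘∁ T)) (interchange ∣ S ∣ _ _ _))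
      h∘∁-submodular : h (∁ (A ∩ B)) + h (∁ (A ∪ B)) ≤ h (∁ A) + h (∁ B)
      h∘∁-submodular = begin
        h (∁ (A ∩ B)) + h (∁ (A ∪ B))  ≡⟨ cong₂ (λ S T → h S + h T) (deMorgan₁ (∪-∩-booleanAlgebra n) A B) (deMorgan₂ (∪-∩-booleanAlgebra n) A B) ⟩
        h (∁ A ∪ ∁ B) + h (∁ A ∩ ∁ B)  ≡⟨ +-comm (h (∁ A ∪ ∁ B)) _ ⟩
        h (∁ A ∩ ∁ B) + h (∁ A ∪ ∁ B)  ≤⟨ ℤₚ.drop‿+≤+ (subm (∁ A) (∁ B)) ⟩
        h (∁ A) + h (∁ B)              ∎
      bound : (f A + f B) + (h (∁ A) + h (∁ B)) ≤ (f (A ∩ B) + f (A ∪ B)) + (h (∁ A) + h (∁ B))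
      bound = begin
        (f A + f B) + (h (∁ A) + h (∁ B))                          ≡⟨ pair A B ⟩
        (∣ A ∣ + ∣ B ∣) + (h ⊤ + h ⊤)                              ≡⟨ cong (_+ (h ⊤ + h ⊤)) (∣p∩q∣+∣p∪q∣≡∣p∣+∣q∣ A B) ⟨
        (∣ A ∩ B ∣ + ∣ A ∪ B ∣) + (h ⊤ + h ⊤)                      ≡⟨ pair (A ∩ B) (A ∪ B) ⟨
        (f (A ∩ B) + f (A ∪ B)) + (h (∁ (A ∩ B)) + h (∁ (A ∪ B)))  ≤⟨ +-monoʳ-≤ (f (A ∩ B) + f (A ∪ B)) h∘∁-submodular ⟩
        (f (A ∩ B) + f (A ∪ B)) + (h (∁ A) + h (∁ B))              ∎

    dualPlusCard-density : (F : Subset n) → (h F ≥ h ⊤) ⇔ DensityAtMostOne (restrict (toℤ f) (∁ F))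
    dualPlusCard-density F = mk⇔ to from
      where
      to : h F ≥ h ⊤ → DensityAtMostOne (restrict (toℤ f) (∁ F))
      to h⊤≤hF with nonempty? (∁ F)
      ... | no ∁F-empty = inj₁ ∁F-empty
      -- All ratios equal 1, so any nonempty subset attains the maximum; `∁ F` is one at hand.
      ... | yes ne = inj₂ (1ℚ , record
          { attained   = (∁ F , ⊆-refl) , ne , ratio≡1 (∁ F , ⊆-refl) ne
          ; upperBound = λ S neS → ℚₚ.≤-reflexive (ratio≡1 S neS) } , ℚₚ.≤-refl)
        where
        ratio≡1 : ∀ S neS → ratio (restrict (toℤ f) (∁ F)) S neS ≡ 1ℚ
        ratio≡1 (S , S⊆∁F) neS = trans
          (ℚₚ./-cong {{nonempty⇒nonZero neS}} {{nonempty⇒nonZero neS}} (cong +_ fS≡∣S∣) refl)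
          (n/n≡1 ∣ S ∣ {{nonempty⇒nonZero neS}})
          where
          fS≡∣S∣ : f S ≡ ∣ S ∣
          -- `S ⊆ ∁ F` gives `F ⊆ ∁ S`, hence `h ⊤ ≤ h F ≤ h (∁ S)` and the truncated difference
          -- vanishes.
          fS≡∣S∣ = trans
            (cong (_+_ ∣ S ∣) (m≤n⇒m∸n≡0 (≤-trans h⊤≤hF (ℤₚ.drop‿+≤+ (mono F (∁ S) (p⊆∁q⇒q⊆∁p S⊆∁F))))))
            (+-identityʳ ∣ S ∣)

      from : DensityAtMostOne (restrict (toℤ f) (∁ F)) → h F ≥ h ⊤
      from (inj₁ ∁F-empty) = ℤₚ.drop‿+≤+ (mono ⊤ F λ {x} _ → x∉∁p⇒x∈p (λ x∈∁F → ∁F-empty (x , x∈∁F)))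
      from (inj₂ (d , isDensity , d≤1)) with nonempty? (∁ F)
      ... | no ∁F-empty = from (inj₁ ∁F-empty)
      -- The density bound is applied to `∁ F` only: it gives `f (∁ F) ≤ ∣ ∁ F ∣`, and cancelling
      -- the cardinality leaves `h ⊤ ≤ h (∁ (∁ F))`.
      ... | yes ne = subst (λ S → h ⊤ ≤ h S) (∁-involutive F) (+-cancelˡ-≤ ∣ ∁ F ∣ _ _ (begin
          ∣ ∁ F ∣ + h ⊤          ≡⟨ dualPlusCard+h∘∁ (∁ F) ⟨
          f (∁ F) + h (∁ (∁ F))  ≤⟨ +-monoˡ-≤ _ (m/n≤1⇒m≤n (f (∁ F)) ∣ ∁ F ∣ {{nonempty⇒nonZero ne}}
                                        (ℚₚ.≤-trans (IsDensity.upperBound isDensity (∁ F , ⊆-refl) ne) d≤1)) ⟩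
          ∣ ∁ F ∣ + h (∁ (∁ F))  ∎))
        where open ≤-Reasoning

    -- Normalization makes `f ⊤` equal to `n + h ⊤`, while `f (∁ ⁅ v ⁆)` is
    -- `(n ∸ 1) + (h ⊤ ∸ h ⁅ v ⁆)`. Writing `f ⊤` as a sum ending in `f (∁ ⁅ v ⁆)` makes the integer
    -- difference a natural number.
    dualPlusCard-marginal : Normalized (toℤ h) →
      (v : Fin n) → marginal (toℤ f) v (⊤ - v) ≡ toℤ h ⁅ v ⁆ ℤ.+ + 1
    dualPlusCard-marginal norm v = begin
      + f ((⊤ - v) ∪ ⁅ v ⁆) ℤ.- + f (⊤ - v)        ≡⟨ cong (λ S → + f (S ∪ ⁅ v ⁆) ℤ.- + f S) (⊤─p≡∁p ⁅ v ⁆) ⟩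
      + f (∁ ⁅ v ⁆ ∪ ⁅ v ⁆) ℤ.- + f (∁ ⁅ v ⁆)      ≡⟨ cong (λ S → + f S ℤ.- + f (∁ ⁅ v ⁆)) (trans (∪-comm (∁ ⁅ v ⁆) ⁅ v ⁆) (p∪∁p≡⊤ ⁅ v ⁆)) ⟩
      + f ⊤ ℤ.- + f (∁ ⁅ v ⁆)                      ≡⟨ ℤₚ.m-n≡m⊖n (f ⊤) (f (∁ ⁅ v ⁆)) ⟩
      f ⊤ ℤ.⊖ f (∁ ⁅ v ⁆)                          ≡⟨ cong (ℤ._⊖ f (∁ ⁅ v ⁆)) f⊤ ⟩
      (h ⁅ v ⁆ + 1 + f (∁ ⁅ v ⁆)) ℤ.⊖ f (∁ ⁅ v ⁆)  ≡⟨ ℤₚ.⊖-≥ (m≤n+m (f (∁ ⁅ v ⁆)) (h ⁅ v ⁆ + 1)) ⟩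
      + (h ⁅ v ⁆ + 1 + f (∁ ⁅ v ⁆) ∸ f (∁ ⁅ v ⁆))  ≡⟨ cong +_ (m+n∸n≡m (h ⁅ v ⁆ + 1) (f (∁ ⁅ v ⁆))) ⟩
      + (h ⁅ v ⁆ + 1)                              ∎
      where
      open ≡-Reasoning
      -- The element `v` itself keeps `n ∸ 1` from truncating.
      1≤n : 1 ≤ n
      1≤n = ≤-trans (s≤s z≤n) (toℕ<n v)
      rearrange : ∀ a b c → (a + 1) + b + c ≡ (c + 1) + (a + b)
      rearrange = solve-∀
      f⊤ : f ⊤ ≡ h ⁅ v ⁆ + 1 + f (∁ ⁅ v ⁆)
      f⊤ = begin
        ∣ ⊤ {n} ∣ + (h ⊤ ∸ h (∁ ⊤))                    ≡⟨ cong₂ (λ k T → k + (h ⊤ ∸ h T)) (∣⊤∣≡n n) (¬⊤≈⊥ (∪-∩-booleanAlgebra n)) ⟩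
        n + (h ⊤ ∸ h ⊥)                                ≡⟨ cong (λ k → n + (h ⊤ ∸ k)) (ℤₚ.+-injective norm) ⟩
        n + h ⊤                                        ≡⟨ cong (_+ h ⊤) (m∸n+n≡m 1≤n) ⟨
        (n ∸ 1) + 1 + h ⊤                              ≡⟨ cong (λ k → (n ∸ k) + 1 + h ⊤) (∣⁅x⁆∣≡1 v) ⟨
        (n ∸ ∣ ⁅ v ⁆ ∣) + 1 + h ⊤                      ≡⟨ cong (λ k → k + 1 + h ⊤) (∣∁p∣≡n∸∣p∣ ⁅ v ⁆) ⟨
        ∣ ∁ ⁅ v ⁆ ∣ + 1 + h ⊤                          ≡⟨ cong (_+_ (∣ ∁ ⁅ v ⁆ ∣ + 1)) (m∸n+n≡m (h≤h⊤ ⁅ v ⁆)) ⟨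
        ∣ ∁ ⁅ v ⁆ ∣ + 1 + (h ⊤ ∸ h ⁅ v ⁆ + h ⁅ v ⁆)    ≡⟨ +-assoc (∣ ∁ ⁅ v ⁆ ∣ + 1) _ _ ⟨
        ∣ ∁ ⁅ v ⁆ ∣ + 1 + (h ⊤ ∸ h ⁅ v ⁆) + h ⁅ v ⁆    ≡⟨ rearrange ∣ ∁ ⁅ v ⁆ ∣ _ _ ⟩
        h ⁅ v ⁆ + 1 + (∣ ∁ ⁅ v ⁆ ∣ + (h ⊤ ∸ h ⁅ v ⁆))  ≡⟨ cong (λ S → h ⁅ v ⁆ + 1 + (∣ ∁ ⁅ v ⁆ ∣ + (h ⊤ ∸ h S))) (∁-involutive ⁅ v ⁆) ⟨
        h ⁅ v ⁆ + 1 + f (∁ ⁅ v ⁆)                      ∎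

-- The evaluation program

n<2^n : ∀ n → n < 2 ^ n
n<2^n zero    = s≤s z≤n
n<2^n (suc n) = begin-strict
  suc n                <⟨ s≤s (n<2^n n) ⟩
  1 + 2 ^ n            ≤⟨ +-mono-≤ (m^n>0 2 n) (m≤m+n (2 ^ n) 0) ⟩
  2 ^ n + (2 ^ n + 0)  ∎
  where open ≤-Reasoning

size-mono-≤ : ∀ {m n} → m ≤ n → size m ≤ size n
size-mono-≤ m≤n = s≤s (⌊log₂⌋-mono-≤ m≤n)

-- The crude bound of a logarithm by its argument, from `n < 2 ^ n`. It suffices because counters,
-- positions and cardinalities never exceed `n`.
size≤1+ : ∀ {m n} → m ≤ n → size m ≤ suc n
size≤1+ {m} {n} m≤n = s≤s (begin
  ⌊log₂ m ⌋      ≤⟨ ⌊log₂⌋-mono-≤ (≤-trans m≤n (<⇒≤ (n<2^n n))) ⟩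
  ⌊log₂ 2 ^ n ⌋  ≡⟨ ⌊log₂[2^n]⌋≡n n ⟩
  n              ∎)
  where open ≤-Reasoning

-- Bounds the cost of every instruction that handles at most two numbers, of size at most 1 + m.
unit : ℕ → ℕ
unit m = 3 + 2 * m

cost₂≤unit : ∀ {a b m} → a ≤ suc m → b ≤ suc m → 1 + a + b ≤ unit m
cost₂≤unit {a} {b} {m} a≤ b≤ = begin
  1 + a + b            ≤⟨ s≤s (+-mono-≤ a≤ b≤) ⟩
  1 + (suc m + suc m)  ≡⟨ lemma m ⟩
  unit m               ∎
  where
  open ≤-Reasoning
  lemma : ∀ m → 1 + (suc m + suc m) ≡ 3 + 2 * m
  lemma = solve-∀

cost₁≤unit : ∀ {a m} → a ≤ suc m → 1 + a ≤ unit m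
cost₁≤unit {a} a≤ = ≤-trans (m≤m+n (1 + a) 0) (cost₂≤unit a≤ z≤n)

-- A total-correctness triple with time bound `b` and postcondition `I`. The query count is fixed at
-- 0 since loops never consult the oracle.
Executes : (h : Subset n → ℕ) (S : Subset n) → Program → State → ℕ → (State → Set) → Set
Executes h S P σ b I = ∃[ σ′ ] ∃[ t ] Run h S P σ σ′ t 0 × t ≤ b × I σ′

-- Induction on the counter in X₁. Each pass costs a test and the body; the last `unit n` pays for
-- the failing test.
while-countdown : {h : Subset n → ℕ} {S : Subset n} {P : Program} {b : ℕ} (I : ℕ → State → Set) →
  (∀ {k σ} → I k σ → reg σ 1 ≡ k) →
  (∀ {k σ} → k < n → I (suc k) σ → Executes h S P σ b (I k)) →
  ∀ k {σ} → k ≤ n → I k σ → Executes h S (while 1 P) σ (k * (unit n + b) + unit n) (I 0)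
while-countdown I counter step zero {σ} k≤n Iσ =
  σ , _ , whileFalse (counter Iσ) , cost₁≤unit (size≤1+ (≤-trans (≤-reflexive (counter Iσ)) k≤n)) , Iσ
while-countdown {n = n} {b = b} I counter step (suc k) {σ} k<n Iσ
  with step k<n Iσ
... | σ′ , t , run , t≤ , Iσ′
  with while-countdown I counter step k (<⇒≤ k<n) Iσ′
... | σ″ , t′ , run′ , t′≤ , Iσ″ =
  σ″ , _ , whileTrue (subst (0 <_) (sym (counter Iσ)) (s≤s z≤n)) run run′ , bound , Iσ″
  where
  open ≤-Reasoning
  bound : 1 + size (reg σ 1) + t + t′ ≤ suc k * (unit n + b) + unit n
  bound = begin
    1 + size (reg σ 1) + t + t′               ≤⟨ +-mono-≤ (+-mono-≤ (cost₁≤unit (size≤1+ (≤-trans (≤-reflexive (counter Iσ)) k<n))) t≤) t′≤ ⟩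
    unit n + b + (k * (unit n + b) + unit n)  ≡⟨ +-assoc (unit n + b) _ _ ⟨
    suc k * (unit n + b) + unit n             ∎

-- The scan descends, so its running count is over the final segment of positions from `k` on.
cardFrom : Subset n → ℕ → ℕ
cardFrom S       zero    = ∣ S ∣
cardFrom []      (suc k) = 0
cardFrom (_ ∷ S) (suc k) = cardFrom S k

cardFrom-suc : (S : Subset n) (k : ℕ) → cardFrom S (suc k) + indicator S k ≡ cardFrom S k
cardFrom-suc []          zero    = refl
cardFrom-suc []          (suc k) = refl
cardFrom-suc (true  ∷ S) zero    = +-comm ∣ S ∣ 1
cardFrom-suc (false ∷ S) zero    = +-identityʳ ∣ S ∣
cardFrom-suc (true  ∷ S) (suc k) = cardFrom-suc S k
cardFrom-suc (false ∷ S) (suc k) = cardFrom-suc S k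

cardFrom-n≡0 : (S : Subset n) → cardFrom S n ≡ 0
cardFrom-n≡0 []      = refl
cardFrom-n≡0 (_ ∷ S) = cardFrom-n≡0 S

cardFrom≤n : (S : Subset n) (k : ℕ) → cardFrom S k ≤ n
cardFrom≤n S       zero    = ∣p∣≤n S
cardFrom≤n []      (suc k) = z≤n
cardFrom≤n (_ ∷ S) (suc k) = m≤n⇒m≤1+n (cardFrom≤n S k)

indicator≤1 : (S : Subset n) (k : ℕ) → indicator S k ≤ 1
indicator≤1 []          k       = z≤n
indicator≤1 (true  ∷ S) zero    = s≤s z≤n
indicator≤1 (false ∷ S) zero    = z≤n
indicator≤1 (true  ∷ S) (suc k) = indicator≤1 S k
indicator≤1 (false ∷ S) (suc k) = indicator≤1 S k

-- Has the shape of the bit computed by `writeComplement`: subtraction from 1, then the positivity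
-- test of `write`.
coindicator : Subset n → ℕ → Bool
coindicator S k = 0 <ᵇ (1 ∸ indicator S k)

coindicator≡lookup∁ : (S : Subset n) (i : Fin n) → coindicator S (toℕ i) ≡ lookup (∁ S) i
coindicator≡lookup∁ (true  ∷ S) zero    = refl
coindicator≡lookup∁ (false ∷ S) zero    = refl
coindicator≡lookup∁ (true  ∷ S) (suc i) = coindicator≡lookup∁ S i
coindicator≡lookup∁ (false ∷ S) (suc i) = coindicator≡lookup∁ S i

-- After scanning the positions k, …, n-1 downwards: X₀ holds the value r, X₁ the position k,
-- X₂ the constant 1, X₅ the count c k, and the tape agrees with g on the scanned positions.
record Scanned (n : ℕ) (g : ℕ → Bool) (r : ℕ) (c : ℕ → ℕ) (k : ℕ) (σ : State) : Set where
  field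
    value   : reg σ 0 ≡ r
    counter : reg σ 1 ≡ k
    one     : reg σ 2 ≡ 1
    count   : reg σ 5 ≡ c k
    written : ∀ j → k ≤ j → j < n → tape σ j ≡ g j

open Scanned

update-written : {m g : ℕ → Bool} {i k : ℕ} {b : Bool} →
  (∀ j → suc k ≤ j → j < n → m j ≡ g j) → i ≡ k → b ≡ g k →
  ∀ j → k ≤ j → j < n → (m [ i ↦ b ]) j ≡ g j
-- The test inside the update is abstracted together with both directions of its specification. If
-- it fails, `j` lies strictly above `i` and was scanned before.
update-written {i = i} old refl b≡gi j i≤j j<n with j ≡ᵇ i | ≡ᵇ⇒≡ j i | ≡⇒≡ᵇ j i
... | true  | j≡i | _   = trans b≡gi (cong _ (sym (j≡i _)))
... | false | _   | j≢i = old j (≤∧≢⇒< i≤j (j≢i ∘ sym)) j<n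

tapeSet≡ : {g : ℕ → Bool} {r : ℕ} {c : ℕ → ℕ} {σ : State} → Scanned n g r c 0 σ →
  (T : Subset n) → (∀ i → g (toℕ i) ≡ lookup T i) → tapeSet σ ≡ T
tapeSet≡ scanned T g≡T =
  trans (tabulate-cong λ i → trans (written scanned (toℕ i) z≤n (toℕ<n i)) (g≡T i)) (tabulate∘lookup T)

-- X₂ holds 1 and serves both as decrement and as the positive value written. The decrement comes
-- first: counter `suc k` stands for position `k`.
writeAll : Program
writeAll = sub 1 1 2 ⨾ write 1 2

writeComplement : Program
writeComplement = sub 1 1 2 ⨾ member 3 1 ⨾ sub 4 2 3 ⨾ write 1 4 ⨾ add 5 5 3

-- X₀ keeps `h ⊤` during the second pass, which also accumulates `∣ S ∣` in X₅. That pass overwrites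
-- every position below `n`, so the tape needs no clearing.
evaluate : Program
evaluate =
  const 2 1 ⨾ ground 1 ⨾ while 1 writeAll ⨾ query 0 ⨾
  ground 1 ⨾ while 1 writeComplement ⨾ query 6 ⨾
  sub 0 0 6 ⨾ add 0 0 5

module _ {h : Subset n → ℕ} {S : Subset n} {k : ℕ} {σ : State} where

  writeAll-step : k < n → Scanned n (λ _ → true) 0 (λ _ → 0) (suc k) σ →
    Executes h S writeAll σ (unit n + unit n) (Scanned n (λ _ → true) 0 (λ _ → 0) k)
  writeAll-step k<n s = _ , _ , seq sub write ,
    +-mono-≤ (cost₂≤unit (size≤1+ (≤-trans (≤-reflexive (counter s)) k<n)) size₁)
             (cost₂≤unit (size≤1+ (≤-trans (≤-reflexive k≡) (<⇒≤ k<n))) size₁) ,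
    record
      { value   = value s
      ; counter = k≡
      ; one     = one s
      ; count   = count s
      ; written = update-written (written s) k≡ (cong (0 <ᵇ_) (one s))
      }
    where
    size₁ : size (reg σ 2) ≤ suc n
    size₁ = size≤1+ (≤-trans (≤-reflexive (one s)) (≤-trans (s≤s z≤n) k<n))
    k≡ : reg σ 1 ∸ reg σ 2 ≡ k
    k≡ = cong₂ _∸_ (counter s) (one s)

  writeComplement-step : {r : ℕ} → k < n → Scanned n (coindicator S) r (cardFrom S) (suc k) σ →
    Executes h S writeComplement σ (unit n + (unit n + (unit n + (unit n + unit n))))
      (Scanned n (coindicator S) r (cardFrom S) k)
  writeComplement-step k<n s = _ , _ , seq sub (seq member (seq sub (seq write add))) ,
    +-mono-≤ (cost₂≤unit (size≤1+ (≤-trans (≤-reflexive (counter s)) k<n)) (size≤1+ one≤n))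
    (+-mono-≤ (cost₁≤unit (size≤1+ k≤n))
    (+-mono-≤ (cost₂≤unit (size≤1+ one≤n) (size≤1+ ind≤n))
    (+-mono-≤ (cost₂≤unit (size≤1+ k≤n) (size≤1+ (≤-trans (m∸n≤m (reg σ 2) (indicator S (reg σ 1 ∸ reg σ 2))) one≤n)))
              (cost₂≤unit (size≤1+ (≤-trans (≤-reflexive (count s)) (cardFrom≤n S (suc k)))) (size≤1+ ind≤n))))) ,
    record
      { value   = value s
      ; counter = k≡
      ; one     = one s
      ; count   = trans (cong₂ _+_ (count s) (cong (indicator S) k≡)) (cardFrom-suc S k)
      ; written = update-written (written s) k≡ (cong₂ (λ a j → 0 <ᵇ (a ∸ indicator S j)) (one s) k≡)
      }
    where
    one≤n : reg σ 2 ≤ n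
    one≤n = ≤-trans (≤-reflexive (one s)) (≤-trans (s≤s z≤n) k<n)
    k≡ : reg σ 1 ∸ reg σ 2 ≡ k
    k≡ = cong₂ _∸_ (counter s) (one s)
    k≤n : reg σ 1 ∸ reg σ 2 ≤ n
    k≤n = ≤-trans (≤-reflexive k≡) (<⇒≤ k<n)
    ind≤n : indicator S (reg σ 1 ∸ reg σ 2) ≤ n
    ind≤n = ≤-trans (indicator≤1 S _) (≤-trans (s≤s z≤n) k<n)

-- With `x = n + L`, the polynomial is `(9 + 9 * x) * unit x`: nine top-level charges, each loop
-- counted by its failing test, and nine per position, three in the first loop and six in the
-- second.
evaluate-answers : (h : Subset n → ℕ) → AnswersQueries evaluate (27 ∷ 45 ∷ 18 ∷ []) 2 h (dualPlusCard h)
evaluate-answers {n} h S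
  with while-countdown {h = h} {S} (Scanned n (λ _ → true) 0 (λ _ → 0)) counter writeAll-step n
         {setReg (setReg initial 2 1) 1 n} ≤-refl
         (record { value = refl ; counter = refl ; one = refl ; count = refl
                 -- At `k = n` nothing has been scanned, so the tape condition is vacuous.
                 ; written = λ j n≤j j<n → contradiction j<n (≤⇒≯ n≤j) })
... | σ₁ , t₁ , run₁ , t₁≤ , s₁
  with while-countdown {h = h} {S} (Scanned n (coindicator S) (h ⊤) (cardFrom S)) counter writeComplement-step n
         {setReg (setReg σ₁ 0 (h (tapeSet σ₁))) 1 n} ≤-refl
         -- The filled tape makes the first answer `h ⊤`. The first loop leaves X₅ at 0, the count
         -- over the empty final segment.
         (record { value = cong h (tapeSet≡ s₁ ⊤ λ i → sym (lookup-replicate i true)) ; counter = refl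
                 ; one = one s₁ ; count = trans (count s₁) (sym (cardFrom-n≡0 S))
                 ; written = λ j n≤j j<n → contradiction j<n (≤⇒≯ n≤j) })
... | σ₂ , t₂ , run₂ , t₂≤ , s₂ =
  _ , _ , _ ,
  seq const (seq ground (seq run₁ (seq query (seq ground (seq run₂ (seq query (seq sub add))))))) ,
  result , ≤-refl , time
  where
  result : (reg σ₂ 0 ∸ h (tapeSet σ₂)) + reg σ₂ 5 ≡ ∣ S ∣ + (h ⊤ ∸ h (∁ S))
  result = trans
    (cong₂ _+_ (cong₂ _∸_ (value s₂) (cong h (tapeSet≡ s₂ (∁ S) (coindicator≡lookup∁ S)))) (count s₂))
    (+-comm (h ⊤ ∸ h (∁ S)) ∣ S ∣)

  total : ∀ x → let u = 3 + 2 * x in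
    u + (u + ((x * (u + (u + u)) + u) + (u + (u + ((x * (u + (u + (u + (u + (u + u))))) + u) + (u + (u + u)))))))
      ≡ 27 + x * (45 + x * (18 + x * 0))
  total = solve-∀

  time : (L : ℕ) → ((T : Subset n) → size (h T) ≤ L) → _ ≤ eval (27 ∷ 45 ∷ 18 ∷ []) (n + L)
  time L h≤L = begin
    _  ≤⟨ +-mono-≤ (cost₁≤unit {m = x} (s≤s z≤n))
         (+-mono-≤ ground≤
         (+-mono-≤ (≤-trans t₁≤ (+-mono-≤ (*-mono-≤ n≤x (+-mono-≤ u≤ (+-mono-≤ u≤ u≤))) u≤))
         (+-mono-≤ (query≤ (tapeSet σ₁))
         (+-mono-≤ ground≤
         (+-mono-≤ (≤-trans t₂≤ (+-mono-≤ (*-mono-≤ n≤x (+-mono-≤ u≤ (+-mono-≤ u≤ (+-mono-≤ u≤ (+-mono-≤ u≤ (+-mono-≤ u≤ u≤)))))) u≤))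
         (+-mono-≤ (query≤ (tapeSet σ₂))
         (+-mono-≤ (cost₂≤unit (≤-trans (size-mono-≤ (≤-reflexive (value s₂))) (h≤ ⊤)) (h≤ (tapeSet σ₂)))
                   (cost₂≤unit
                     -- The difference left in X₀ is at most `h ⊤`, so its size is still controlled
                     -- by `L`.
                     (≤-trans (size-mono-≤ (≤-trans (m∸n≤m (reg σ₂ 0) (h (tapeSet σ₂))) (≤-reflexive (value s₂)))) (h≤ ⊤))
                     (size≤1+ (≤-trans (≤-reflexive (count s₂)) (≤-trans (∣p∣≤n S) n≤x))))))))))) ⟩
    _  ≡⟨ total x ⟩
    eval (27 ∷ 45 ∷ 18 ∷ []) x  ∎
    where
    open ≤-Reasoning
    x : ℕ
    x = n + L
    n≤x : n ≤ x
    n≤x = m≤m+n n L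
    u≤ : unit n ≤ unit x
    u≤ = +-monoʳ-≤ 3 (*-monoʳ-≤ 2 n≤x)
    h≤ : ∀ T → size (h T) ≤ suc x
    h≤ T = ≤-trans (h≤L T) (m≤n⇒m≤1+n (m≤n+m L n))
    ground≤ : 1 + size n ≤ unit x
    ground≤ = cost₁≤unit (size≤1+ n≤x)
    query≤ : ∀ T → 1 + n + size (h T) ≤ unit x
    query≤ T = cost₂≤unit (m≤n⇒m≤1+n n≤x) (h≤ T)

theorem1p2 : ∃[ P ] ∃[ p ] ∃[ c ]
    ((n : ℕ) (h : Subset n → ℕ) →
    Normalized (toℤ h) → NonDecreasing (toℤ h) → Submodular (toℤ h) →
    ∃[ f ]
    Normalized (toℤ f)
    × Supermodular (toℤ f)
    × ((F : Subset n) → (h F ≥ h ⊤) ⇔ DensityAtMostOne (restrict (toℤ f) (∁ F)))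
    × ((v : Fin n) → marginal (toℤ f) v (⊤ - v) ≡ toℤ h ⁅ v ⁆ ℤ.+ + 1)
    × AnswersQueries P p c h f)
theorem1p2 = evaluate , (27 ∷ 45 ∷ 18 ∷ []) , 2 , λ n h norm mono subm →
  dualPlusCard h ,
  dualPlusCard-normalized h ,
  dualPlusCard-supermodular h mono subm ,
  dualPlusCard-density h mono ,
  dualPlusCard-marginal h mono norm ,
  evaluate-answers h
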